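{- (Coinduction principle.) Let $\Sigma$ be a first-order signature, $\varphi(X_1,\ldots,X_m)$ a standard formula over $\Sigma$ with free relational variables among $X_1,\ldots,X_m$ and no free individual variables, and $\mathbb{A}$ a $\Sigma$-structure. Let $R_1,\ldots,R_m$ be coinductive relations on (the carrier of) $\mathbb{A}$ with arities matching those of $X_1,\ldots,X_m$, with approximants $R_i^\alpha$. Suppose that for every ordinal $\alpha$, if $\mathbb{A}\models\varphi(R_1^\alpha,\ldots,R_m^\alpha)$ then $\mathbb{A}\models\varphi(R_1^{\alpha+1},\ldots,R_m^{\alpha+1})$. Then $\mathbb{A}\models\varphi(R_1^\alpha,\ldots,R_m^\alpha)$ for every ordinal $\alpha$; in particular $\mathbb{A}\models\varphi(R_1,\ldots,R_m)$.
   Context: Formulas are first-order formulas over $\Sigma$ additionally allowing free (never bound) relational variables; quantification is only over individuals. A formula is standard if it is equivalent to a conjunction of formulas of the form $\forall x_1\ldots\forall x_n\big(\psi(x_1,\ldots,x_n,X_1,\ldots,X_m)\to X_{i_1}(t^1_1,\ldots,t^1_{n_1})\land\cdots\land X_{i_k}(t^k_1,\ldots,t^k_{n_k})\big)$ with $\psi$ quantifier-free and $t^j_l$ terms. An $n$-ary relation $R\subseteq A^n$ is coinductive if it is the greatest fixpoint of a (specified) monotone $F:\mathcal{P}(A^n)\to\mathcal{P}(A^n)$; its approximants (the final sequence of $F$) are $R^0=A^n$, $R^{\alpha+1}=F(R^\alpha)$, and $R^\lambda=\bigcap_{\alpha<\lambda}R^\alpha$ for limit ordinals $\lambda$. $\varphi(R_1,\ldots,R_m)$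 denotes $\varphi$ with each $X_i$ interpreted as $R_i$. -}

module Defs where

open import Level using (Level; _⊔_) renaming (suc to lsuc)
open import Data.Nat using (ℕ; zero; suc)
open import Data.Fin using (Fin)
open import Data.Vec using (Vec; []; _∷_; lookup)
open import Data.List using (List; foldr; map)
open import Data.Product using (Σ; _×_; _,_; ∃-syntax)
open import Data.Sum using (_⊎_)
open import Data.Empty.Polymorphic using (⊥)
open import Data.Unit.Polymorphic using (⊤; tt)
open import Function using (_⇔_; mk⇔)
open import Relation.Binary.PropositionalEquality using (_≡_)
open import Relation.Unary using (Pred; U; _⊆_; _≐_)

private variable
  s ℓ : Level

record Signature (s : Level) : Set (lsuc s) where
  field
    Function      : Set s
    arity         : Function → ℕ
    Relation      : Set s
    relationArity : Relation → ℕ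

record Structure (S : Signature s) (ℓ : Level) : Set (s ⊔ lsuc ℓ) where
  open Signature S
  field
    Carrier  : Set ℓ
    function : (f : Function) → Vec Carrier (arity f) → Carrier
    relation : (P : Relation) → Pred (Vec Carrier (relationArity P)) ℓ

open Structure public using (Carrier)

-- Individual variables are de Bruijn indices: `Term S n` and `Formula S ar n`
-- have their free individual variables among n many.

data Term (S : Signature s) (n : ℕ) : Set s where
  var : Fin n → Term S n
  app : (f : Signature.Function S) → Vec (Term S n) (Signature.arity S f) → Term S n

infix  8 _≈ᶠ_
infixr 7 _∧ᶠ_
infixr 6 _∨ᶠ_
infixr 5 _⇒ᶠ_

-- The relational variables are X i for i : Fin m, of arity ar i; no constructor
-- binds them.  Negation of φ is φ ⇒ᶠ ⊥ᶠ.
data Formula (S : Signature s) {m : ℕ} (ar : Fin m → ℕ) (n : ℕ) : Set s where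
  ⊤ᶠ ⊥ᶠ          : Formula S ar n
  _≈ᶠ_           : Term S n → Term S n → Formula S ar n
  rel            : (P : Signature.Relation S) →
                   Vec (Term S n) (Signature.relationArity S P) → Formula S ar n
  X              : (i : Fin m) → Vec (Term S n) (ar i) → Formula S ar n
  _∧ᶠ_ _∨ᶠ_ _⇒ᶠ_ : Formula S ar n → Formula S ar n → Formula S ar n
  ∀ᶠ_ ∃ᶠ_        : Formula S ar (suc n) → Formula S ar n

module _ {S : Signature s} (𝔸 : Structure S ℓ) where

  mutual
    ⟦_⟧ : ∀ {n} → Term S n → Vec (Carrier 𝔸) n → Carrier 𝔸
    ⟦ var x ⟧    ρ = lookup ρ x
    ⟦ app f ts ⟧ ρ = Structure.function 𝔸 f (⟦ ts ⟧* ρ)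

    ⟦_⟧* : ∀ {n k} → Vec (Term S n) k → Vec (Carrier 𝔸) n → Vec (Carrier 𝔸) k
    ⟦ [] ⟧*     ρ = []
    ⟦ t ∷ ts ⟧* ρ = ⟦ t ⟧ ρ ∷ ⟦ ts ⟧* ρ

  Relations : ∀ {m} → (Fin m → ℕ) → Set (lsuc ℓ)
  Relations ar = ∀ i → Pred (Vec (Carrier 𝔸) (ar i)) ℓ

  Sat : ∀ {m} {ar : Fin m → ℕ} {n} →
        Formula S ar n → Relations ar → Vec (Carrier 𝔸) n → Set ℓ
  Sat ⊤ᶠ         R ρ = ⊤
  Sat ⊥ᶠ         R ρ = ⊥
  Sat (t ≈ᶠ u)   R ρ = ⟦ t ⟧ ρ ≡ ⟦ u ⟧ ρ
  Sat (rel P ts) R ρ = Structure.relation 𝔸 P (⟦ ts ⟧* ρ)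
  Sat (X i ts)   R ρ = R i (⟦ ts ⟧* ρ)
  Sat (φ ∧ᶠ χ)   R ρ = Sat φ R ρ × Sat χ R ρ
  Sat (φ ∨ᶠ χ)   R ρ = Sat φ R ρ ⊎ Sat χ R ρ
  Sat (φ ⇒ᶠ χ)   R ρ = Sat φ R ρ → Sat χ R ρ
  Sat (∀ᶠ φ)     R ρ = ∀ a → Sat φ R (a ∷ ρ)
  Sat (∃ᶠ φ)     R ρ = ∃[ a ] Sat φ R (a ∷ ρ)

infix 4 _⊨_[_]

_⊨_[_] : {S : Signature s} (𝔸 : Structure S ℓ) {m : ℕ} {ar : Fin m → ℕ} →
         Formula S ar 0 → Relations 𝔸 ar → Set ℓ
𝔸 ⊨ φ [ R ] = Sat 𝔸 φ R []

module _ {S : Signature s} {m : ℕ} {ar : Fin m → ℕ} where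

  data QuantifierFree {n : ℕ} : Formula S ar n → Set s where
    ⊤ᶠ   : QuantifierFree ⊤ᶠ
    ⊥ᶠ   : QuantifierFree ⊥ᶠ
    _≈ᶠ_ : ∀ t u → QuantifierFree (t ≈ᶠ u)
    rel  : ∀ P ts → QuantifierFree (rel P ts)
    X    : ∀ i ts → QuantifierFree (X i ts)
    _∧ᶠ_ : ∀ {φ χ} → QuantifierFree φ → QuantifierFree χ → QuantifierFree (φ ∧ᶠ χ)
    _∨ᶠ_ : ∀ {φ χ} → QuantifierFree φ → QuantifierFree χ → QuantifierFree (φ ∨ᶠ χ)
    _⇒ᶠ_ : ∀ {φ χ} → QuantifierFree φ → QuantifierFree χ → QuantifierFree (φ ⇒ᶠ χ)

  ⋀ : ∀ {n} → List (Formula S ar n) → Formula S ar n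
  ⋀ = foldr _∧ᶠ_ ⊤ᶠ

  ∀* : ∀ n → Formula S ar n → Formula S ar 0
  ∀* zero    φ = φ
  ∀* (suc n) φ = ∀* n (∀ᶠ φ)

  record Clause : Set s where
    field
      n              : ℕ
      premise        : Formula S ar n
      quantifierFree : QuantifierFree premise
      conclusions    : List (Σ (Fin m) λ i → Vec (Term S n) (ar i))

    formula : Formula S ar 0
    formula = ∀* n (premise ⇒ᶠ ⋀ (map (λ (i , ts) → X i ts) conclusions))

  Equivalent : ∀ ℓ → Formula S ar 0 → Formula S ar 0 → Set (s ⊔ lsuc ℓ)
  Equivalent ℓ φ χ = (𝔸 : Structure S ℓ) (R : Relations 𝔸 ar) → 𝔸 ⊨ φ [ R ] ⇔ 𝔸 ⊨ χ [ R ]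

  Standard : ∀ ℓ → Formula S ar 0 → Set (s ⊔ lsuc ℓ)
  Standard ℓ φ = ∃[ cs ] Equivalent ℓ φ (⋀ (map Clause.formula cs))

-- The class of ordinals relative to the universe Set ℓ: `sup I f` is the least
-- ordinal strictly above every f i.  Different trees may denote the same ordinal,
-- so equality of ordinals is _≈_, not _≡_.
data Ordinal (ℓ : Level) : Set (lsuc ℓ) where
  sup : (I : Set ℓ) → (I → Ordinal ℓ) → Ordinal ℓ

infix 4 _≤_ _<_ _≈_

mutual
  _≤_ : Ordinal ℓ → Ordinal ℓ → Set ℓ
  sup I f ≤ β = ∀ i → f i < β

  _<_ : Ordinal ℓ → Ordinal ℓ → Set ℓ
  α < sup J g = ∃[ j ] α ≤ g j

_≈_ : Ordinal ℓ → Ordinal ℓ → Set ℓ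
α ≈ β = α ≤ β × β ≤ α

0ᵒ : Ordinal ℓ
0ᵒ = sup ⊥ λ ()

infix 9 _+1

_+1 : Ordinal ℓ → Ordinal ℓ
α +1 = sup ⊤ λ _ → α

IsLimit : Ordinal ℓ → Set (lsuc ℓ)
IsLimit l = 0ᵒ < l × (∀ α → α < l → α +1 < l)

module _ {A : Set ℓ} where

  Monotone : (Pred A ℓ → Pred A ℓ) → Set (lsuc ℓ)
  Monotone F = ∀ {P Q} → P ⊆ Q → F P ⊆ F Q

  record IsGreatestFixpoint (F : Pred A ℓ → Pred A ℓ) (R : Pred A ℓ) : Set (lsuc ℓ) where
    field
      fixpoint : R ≐ F R
      greatest : ∀ P → P ≐ F P → P ⊆ R

  record IsFinalSequence (F : Pred A ℓ → Pred A ℓ) (R : Ordinal ℓ → Pred A ℓ) : Set (lsuc ℓ) where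
    field
      -- R is a function of the ordinal, not of the tree denoting it.
      cong      : ∀ {α β} → α ≈ β → R α ≐ R β
      at-zero   : R 0ᵒ ≐ U
      at-suc    : ∀ α → R (α +1) ≐ F (R α)
      -- R l is ⋂_{α<l} R α; stdlib's ⋂ would land one universe too high here.
      at-limit  : ∀ l → IsLimit l → ∀ x → R l x ⇔ (∀ α → α < l → R α x)

  -- Final sequences exist, so quantifying over them is never vacuous.
  module FinalSequence (F : Pred A ℓ → Pred A ℓ) (mono : Monotone F) where

    sequence : Ordinal ℓ → Pred A ℓ
    sequence (sup I f) x = ∀ i → F (sequence (f i)) x

    antitone : ∀ α β → α ≤ β → sequence β ⊆ sequence α
    antitone (sup I f) (sup J g) α≤β x∈β i with α≤β i
    ... | j , fi≤gj = mono (antitone (f i) (g j) fi≤gj) (x∈β j)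

    ≤-refl : ∀ (α : Ordinal ℓ) → α ≤ α
    ≤-refl (sup I f) i = i , ≤-refl (f i)

    <⇒≤ : ∀ (α β : Ordinal ℓ) → α < β → α ≤ β
    <⇒≤ (sup I f) (sup J g) (j , α≤gj) i = j , <⇒≤ (f i) (g j) (α≤gj i)

    isFinalSequence : IsFinalSequence F sequence
    isFinalSequence = record
      { cong      = λ {α} {β} (p , q) → antitone β α q , antitone α β p
      ; at-zero   = (λ _ → _) , λ _ ()
      ; at-suc    = λ α → (λ x∈ → x∈ tt) , λ x∈ _ → x∈
      ; at-limit  = lim
      }
      where
      lim : ∀ l → IsLimit l → ∀ x → sequence l x ⇔ (∀ α → α < l → sequence α x)
      lim l@(sup I f) (_ , closed) x = mk⇔
        (λ x∈l α α<l → antitone α l (<⇒≤ α l α<l) x∈l)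
        (λ x∈ i → x∈ (f i +1) (closed (f i) (i , ≤-refl (f i))) tt)

record CoinductiveRelation (A : Set ℓ) (n : ℕ) : Set (lsuc ℓ) where
  field
    relation           : Pred (Vec A n) ℓ
    operator           : Pred (Vec A n) ℓ → Pred (Vec A n) ℓ
    monotone           : Monotone operator
    isGreatestFixpoint : IsGreatestFixpoint operator relation
    approximant        : Ordinal ℓ → Pred (Vec A n) ℓ
    isFinalSequence    : IsFinalSequence operator approximant

open CoinductiveRelation public using (relation; approximant)

{-# OPTIONS --safe #-}

-- Transfinite induction on α, with φ replaced by its clauses.  At 0 the conclusions are
-- trivial.  At a limit l, fix an assignment of a clause ∀x̄ (ψ → ⋀ X t): each atom of ψ is
-- decreasing in α, and ψ has finitely many of them, so the truth value of ψ at l is its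
-- value at all sufficiently large α < l.  Hence the conclusions hold at cofinally many
-- α < l, and so at l.
--
-- The greatest fixpoints are the approximants at one common ordinal.  Without choice, it is
-- found by letting y ≺ x mean that y leaves the final sequence strictly before x; this
-- relation is well-founded below every x that leaves at all, and the supremum of its
-- ranks is an ordinal at which the sequence is stable.
module Submission where

open import Level using (Level; Lift; lift; lower) renaming (suc to lsuc)
open import Axiom.ExcludedMiddle using (ExcludedMiddle)
open import Data.Nat using (ℕ; zero; suc)
open import Data.Fin using (Fin)
open import Data.Vec using ([]; _∷_)
open import Data.List using (List; []; _∷_; map)
open import Data.List.Membership.Propositional using (_∈_)
open import Data.List.Relation.Unary.Any using (here; there)
open import Data.Product using (_×_; _,_; proj₁; proj₂; ∃-syntax)
open import Data.Product.Function.NonDependent.Propositional using (_×-⇔_)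
open import Data.Sum using (_⊎_; inj₁; inj₂; [_,_]′)
open import Data.Sum.Function.Propositional using (_⊎-⇔_)
open import Data.Unit.Polymorphic using (tt)
open import Function using (_⇔_; mk⇔; Equivalence; id)
open import Function.Properties.Equivalence using () renaming (refl to ⇔-refl)
open import Function.Related.TypeIsomorphisms using (→-cong-⇔)
open import Induction.WellFounded using (Acc; acc)
open import Relation.Binary.PropositionalEquality using (refl)
open import Relation.Nullary using (¬_; yes; no; contradiction)
open import Relation.Nullary.Decidable using (map′; decidable-stable; True; toWitness; fromWitness)
open import Relation.Unary using (Pred; _⊆_; _≐_)
open import Relation.Unary.Properties using (≐-sym; ≐-trans)
open import Defs

open Equivalence using (to; from)

private variable
  s ℓ p : Level

-- Order and induction on ordinals.

≤-refl : (α : Ordinal ℓ) → α ≤ α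
≤-refl (sup I f) i = i , ≤-refl (f i)

≤-trans : {α β γ : Ordinal ℓ} → α ≤ β → β ≤ γ → α ≤ γ
≤-trans {α = sup _ _} {sup _ _} {sup _ _} α≤β β≤γ i with α≤β i
... | j , fi≤gj with β≤γ j
... | k , gj≤hk = k , ≤-trans fi≤gj gj≤hk

≤-<-trans : {α β γ : Ordinal ℓ} → α ≤ β → β < γ → α < γ
≤-<-trans {γ = sup _ _} α≤β (k , β≤hk) = k , ≤-trans α≤β β≤hk

<-≤-trans : {α β γ : Ordinal ℓ} → α < β → β ≤ γ → α < γ
<-≤-trans {β = sup _ _} (j , α≤gj) β≤γ = ≤-<-trans α≤gj (β≤γ j)

<⇒≤ : {α β : Ordinal ℓ} → α < β → α ≤ β
<⇒≤ {α = sup _ _} {sup _ _} (j , α≤gj) i = j , <⇒≤ (α≤gj i)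

-- Each `β < sup I f` lies under some `f i`, so whatever is below `β` is below a structurally
-- smaller tree.
<-rec : (P : Ordinal ℓ → Set p) → (∀ α → (∀ β → β < α → P β) → P α) → ∀ α → P α
<-rec P step α = step α (below α)
  where
  below : ∀ α β → β < α → P β
  below (sup I f) β (i , β≤fi) = step β λ γ γ<β → below (f i) γ (<-≤-trans γ<β β≤fi)

-- Case analysis and linearity of ordinals.

data ZeroSucLimit {ℓ} (α : Ordinal ℓ) : Set (lsuc ℓ) where
  isZero  : α ≈ 0ᵒ → ZeroSucLimit α
  isSuc   : ∀ β → α ≈ β +1 → ZeroSucLimit α
  isLimit : IsLimit α → ZeroSucLimit α

module Classical {ℓ : Level} (em : ExcludedMiddle (lsuc ℓ)) where

  em↓ : ExcludedMiddle ℓ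
  em↓ = map′ lower lift em

  -- If no `f i` bounds `β`, comparing `β` with each `f i` leaves only `f i < β`. The recursion
  -- swaps the trees and descends into one of them at each call.
  ≤-or-> : (α β : Ordinal ℓ) → α ≤ β ⊎ β < α
  ≤-or-> (sup I f) β with em↓ {∃[ i ] β ≤ f i}
  ... | yes β<α = inj₂ β<α
  ... | no  β≮α = inj₁ λ i →
    [ (λ β≤fi → contradiction (i , β≤fi) β≮α) , id ]′ (≤-or-> β (f i))

  zeroSucLimit : ∀ α → ZeroSucLimit α
  zeroSucLimit α@(sup I f) with em↓ {∃[ i ] ∀ j → f j ≤ f i} | em↓ {I}
  ... | yes (i , max) | _     = isSuc (f i) ((λ j → tt , max j) , λ _ → i , ≤-refl (f i))
  ... | no  _         | no ¬I = isZero ((λ i → contradiction i ¬I) , λ ())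
  ... | no  ¬max      | yes i = isLimit ((i , λ ()) , closed)
    where
    closed : ∀ β → β < α → β +1 < α
    -- If nothing exceeded `f i`, linearity would make it the largest value of the family.
    closed β (i , β≤fi) with em↓ {∃[ k ] f i < f k}
    ... | yes (k , fi<fk) = k , λ _ → ≤-<-trans β≤fi fi<fk
    ... | no  ∄           = contradiction (i , λ j →
      [ id , (λ fi<fj → contradiction (j , fi<fj) ∄) ]′ (≤-or-> (f j) (f i))) ¬max

  -- `P` must respect `≈` because the zero and successor cases determine an ordinal only up to `≈`.
  transfiniteInduction :
    (P : Ordinal ℓ → Set p) → (∀ {α β} → α ≈ β → P β → P α) →
    P 0ᵒ → (∀ α → P α → P (α +1)) → (∀ l → IsLimit l → (∀ α → α < l → P α) → P l) →
    ∀ α → P α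
  transfiniteInduction P resp P0 Ps Pl = <-rec P step
    where
    step : ∀ α → (∀ β → β < α → P β) → P α
    step α ih with zeroSucLimit α
    ... | isZero α≈0             = resp α≈0 P0
    ... | isSuc β α≈β+1@(_ , β<α) = resp α≈β+1 (Ps β (ih β (β<α tt)))
    ... | isLimit lim            = Pl α lim ih

  Eventually : Ordinal ℓ → Pred (Ordinal ℓ) p → Set _
  Eventually l P = ∃[ α₀ ] α₀ < l × (∀ α → α₀ ≤ α → α < l → P α)

  <-directed : ∀ {α β l : Ordinal ℓ} → α < l → β < l → ∃[ γ ] α ≤ γ × β ≤ γ × γ < l
  <-directed {α} {β} α<l β<l with ≤-or-> α β
  ... | inj₁ α≤β = β , α≤β , ≤-refl β , β<l
  ... | inj₂ β<α = α , ≤-refl α , <⇒≤ β<α , α<l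

  eventually-zipWith : ∀ {l} {P Q T : Pred (Ordinal ℓ) p} →
    (∀ {α} → P α → Q α → T α) → Eventually l P → Eventually l Q → Eventually l T
  eventually-zipWith f (α , α<l , P≥α) (β , β<l , Q≥β) with <-directed α<l β<l
  ... | γ , α≤γ , β≤γ , γ<l = γ , γ<l , λ δ γ≤δ δ<l →
    f (P≥α δ (≤-trans α≤γ γ≤δ) δ<l) (Q≥β δ (≤-trans β≤γ γ≤δ) δ<l)

  -- Final sequences and their closure ordinals.

  module _ {A : Set ℓ} {F : Pred A ℓ → Pred A ℓ} (mono : Monotone F) where
    open FinalSequence F mono using (sequence; isFinalSequence)
      renaming (antitone to sequence-antitone)
    open IsFinalSequence

    -- Carries facts proved for `sequence` by recursion on trees over to a final sequence known only
    -- through its equations.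
    finalSequence-unique : ∀ {R R′} → IsFinalSequence F R → IsFinalSequence F R′ →
      ∀ α → R α ≐ R′ α
    finalSequence-unique {R} {R′} fs fs′ = transfiniteInduction (λ α → R α ≐ R′ α)
      (λ α≈β Rβ≐R′β → ≐-trans (cong fs α≈β) (≐-trans Rβ≐R′β (≐-sym (cong fs′ α≈β))))
      (≐-trans (at-zero fs) (≐-sym (at-zero fs′)))
      (λ α (R⊆R′ , R′⊆R) →
        ≐-trans (at-suc fs α) (≐-trans (mono R⊆R′ , mono R′⊆R) (≐-sym (at-suc fs′ α))))
      (λ l lim ih →
        (λ {x} x∈l → from (at-limit fs′ l lim x)
          λ α α<l → proj₁ (ih α α<l) (to (at-limit fs l lim x) x∈l α α<l)) ,
        (λ {x} x∈l → from (at-limit fs l lim x)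
          λ α α<l → proj₂ (ih α α<l) (to (at-limit fs′ l lim x) x∈l α α<l)))

    finalSequence-antitone : ∀ {R} → IsFinalSequence F R → ∀ {α β} → α ≤ β → R β ⊆ R α
    finalSequence-antitone fs {α} {β} α≤β x∈β =
      proj₂ (unique α) (sequence-antitone α β α≤β (proj₁ (unique β) x∈β))
      where unique = finalSequence-unique fs isFinalSequence

    -- Deciding the proposition moves it from Set (lsuc ℓ) down to Set, so that the
    -- predecessors of x can index an Ordinal ℓ.
    _≺_ : A → A → Set
    y ≺ x = True (em {∃[ β ] ¬ sequence β y × sequence β x})

    rank : ∀ {x} → Acc _≺_ x → Ordinal ℓ
    rank {x} (acc rs) = sup (∃[ y ] y ≺ x) λ (y , y≺x) → rank (rs y≺x)

    -- If `y` in stage `rank a` were missing from a stage still containing `x`, then `y ≺ x`, and by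
    -- recursion `y` would never leave. So stage `rank a` lies inside every stage containing `x`,
    -- and applying `F` keeps `x` in the next one.
    leaves-after-rank : ∀ {x} (a : Acc _≺_ x) → F (sequence (rank a)) x → ∀ α → sequence α x
    leaves-after-rank {x} a@(acc rs) x∈ = everywhere
      where
      rank-below : ∀ β → sequence β x → sequence (rank a) ⊆ sequence β
      rank-below β x∈β {y} y∈ = decidable-stable em↓ λ y∉β →
        let y≺x = fromWitness (β , y∉β , x∈β)
        -- At the index `y`, membership in stage `rank a` says that `y` outlasts its own rank.
        in  y∉β (leaves-after-rank (rs y≺x) (y∈ (y , y≺x)) β)

      everywhere : ∀ α → sequence α x
      everywhere (sup I f) i = mono (rank-below (f i) (everywhere (f i))) x∈

    -- A predecessor of `x` leaves before `x` does, hence is already gone at some `f i`, a smaller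
    -- tree.
    leaves⇒acc : ∀ α {x} → ¬ sequence α x → Acc _≺_ x
    leaves⇒acc α@(sup I f) {x} x∉α = acc λ y≺x → predecessor (toWitness y≺x)
      where
      predecessor : ∀ {y} → ∃[ β ] ¬ sequence β y × sequence β x → Acc _≺_ y
      predecessor (β , y∉β , x∈β) with ≤-or-> α β
      ... | inj₁ α≤β        = contradiction (sequence-antitone α β α≤β x∈β) x∉α
      ... | inj₂ (i , β≤fi) = leaves⇒acc (f i) λ y∈fi → y∉β (sequence-antitone β (f i) β≤fi y∈fi)

    closureOrdinal : Ordinal ℓ
    closureOrdinal = sup (∃[ x ] Acc _≺_ x) λ (x , a) → rank a

    -- An element that leaves is accessible, so its rank is strictly below `closureOrdinal`; having
    -- outlasted that rank, it could never leave.
    sequence-stable : ∀ α → sequence closureOrdinal ⊆ sequence α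
    sequence-stable α x∈ = decidable-stable em↓ λ x∉α →
      let a = leaves⇒acc α x∉α in x∉α (leaves-after-rank a (x∈ (_ , a)) α)

    -- Stability makes stage `γ` a fixpoint, and every stage contains `G`. Allowing any later `γ`
    -- lets one stage serve several relations.
    finalSequence-reaches-gfp : ∀ {R G} → IsFinalSequence F R → IsGreatestFixpoint F G →
      ∀ {γ} → closureOrdinal ≤ γ → R γ ≐ G
    finalSequence-reaches-gfp {R} {G} fs gfp {γ} closure≤γ = ≐-trans
      (finalSequence-unique fs isFinalSequence γ)
      (greatest (sequence γ) (stable , shrinking) , below γ)
      where
      open IsGreatestFixpoint gfp

      stable : sequence γ ⊆ F (sequence γ)
      stable x∈ = sequence-stable (γ +1) (sequence-antitone closureOrdinal γ closure≤γ x∈) tt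

      shrinking : F (sequence γ) ⊆ sequence γ
      shrinking x∈ = sequence-antitone γ (γ +1) (<⇒≤ {β = γ +1} (tt , ≤-refl γ)) λ _ → x∈

      below : ∀ α → G ⊆ sequence α
      below (sup I f) x∈G i = mono (below (f i)) (proj₁ fixpoint x∈G)

-- Satisfaction of clauses and the limit step.

module _ {S : Signature s} (𝔸 : Structure S ℓ) {m : ℕ} {ar : Fin m → ℕ} where

  Sat-cong : {R R′ : Relations 𝔸 ar} → (∀ i → R i ≐ R′ i) →
    ∀ {n} (φ : Formula S ar n) ρ → Sat 𝔸 φ R ρ ⇔ Sat 𝔸 φ R′ ρ
  Sat-cong R≐R′ ⊤ᶠ         ρ = ⇔-refl
  Sat-cong R≐R′ ⊥ᶠ         ρ = ⇔-refl
  Sat-cong R≐R′ (t ≈ᶠ u)   ρ = ⇔-refl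
  Sat-cong R≐R′ (rel P ts) ρ = ⇔-refl
  Sat-cong R≐R′ (X i ts)   ρ = mk⇔ (proj₁ (R≐R′ i)) (proj₂ (R≐R′ i))
  Sat-cong R≐R′ (φ ∧ᶠ χ)   ρ = Sat-cong R≐R′ φ ρ ×-⇔ Sat-cong R≐R′ χ ρ
  Sat-cong R≐R′ (φ ∨ᶠ χ)   ρ = Sat-cong R≐R′ φ ρ ⊎-⇔ Sat-cong R≐R′ χ ρ
  Sat-cong R≐R′ (φ ⇒ᶠ χ)   ρ = →-cong-⇔ (Sat-cong R≐R′ φ ρ) (Sat-cong R≐R′ χ ρ)
  Sat-cong R≐R′ (∀ᶠ φ)     ρ = mk⇔
    (λ h a → to   (Sat-cong R≐R′ φ (a ∷ ρ)) (h a))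
    (λ h a → from (Sat-cong R≐R′ φ (a ∷ ρ)) (h a))
  Sat-cong R≐R′ (∃ᶠ φ)     ρ = mk⇔
    (λ (a , h) → a , to   (Sat-cong R≐R′ φ (a ∷ ρ)) h)
    (λ (a , h) → a , from (Sat-cong R≐R′ φ (a ∷ ρ)) h)

  Sat-∀* : (R : Relations 𝔸 ar) → ∀ n {φ : Formula S ar n} →
    Sat 𝔸 (∀* n φ) R [] ⇔ (∀ ρ → Sat 𝔸 φ R ρ)
  Sat-∀* R zero    = mk⇔ (λ { h [] → h }) (λ h → h [])
  Sat-∀* R (suc n) = mk⇔
    (λ { h (a ∷ ρ) → to (Sat-∀* R n) h ρ a })
    (λ h → from (Sat-∀* R n) λ ρ a → h (a ∷ ρ))

  Sat-⋀ : ∀ (R : Relations 𝔸 ar) {n} ρ {b} {B : Set b} {f : B → Formula S ar n} (xs : List B) →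
    Sat 𝔸 (⋀ (map f xs)) R ρ ⇔ (∀ {x} → x ∈ xs → Sat 𝔸 (f x) R ρ)
  Sat-⋀ R ρ []       = mk⇔ (λ _ ()) (λ _ → tt)
  Sat-⋀ R ρ (x ∷ xs) = mk⇔
    (λ { (h , hs) (here refl)  → h
       ; (h , hs) (there x∈xs) → to (Sat-⋀ R ρ xs) hs x∈xs })
    (λ h → h (here refl) , from (Sat-⋀ R ρ xs) λ x∈xs → h (there x∈xs))

  module _ (em : ExcludedMiddle (lsuc ℓ)) where
    open Classical em

    module _ (R : Ordinal ℓ → Relations 𝔸 ar)
             (antitone : ∀ i {α β} → α ≤ β → R β i ⊆ R α i)
             {l : Ordinal ℓ} (0<l : 0ᵒ < l)
             (continuous : ∀ i {x} → (∀ α → α < l → R α i x) → R l i x)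
             where

      always : ∀ {P : Pred (Ordinal ℓ) ℓ} → (∀ {α} → α < l → P α) → Eventually l P
      always h = 0ᵒ , 0<l , λ α _ α<l → h α<l

      -- Only relational atoms vary with `α`. Stating stability as an equivalence lets it pass
      -- through implications, where monotonicity would be lost.
      quantifierFree-stable : ∀ {n} {φ : Formula S ar n} → QuantifierFree φ → ∀ ρ →
        Eventually l λ α → Sat 𝔸 φ (R α) ρ ⇔ Sat 𝔸 φ (R l) ρ
      quantifierFree-stable ⊤ᶠ         ρ = always λ _ → ⇔-refl
      quantifierFree-stable ⊥ᶠ         ρ = always λ _ → ⇔-refl
      quantifierFree-stable (t ≈ᶠ u)   ρ = always λ _ → ⇔-refl
      quantifierFree-stable (rel P ts) ρ = always λ _ → ⇔-refl
      quantifierFree-stable (X i ts)   ρ with em {∃[ α ] α < l × ¬ R α i (⟦_⟧* 𝔸 ts ρ)}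
      -- By antitonicity, an atom failing at `α` fails at all later stages, including `l`.
      ... | yes (α , α<l , ∉α) = α , α<l , λ β α≤β β<l → mk⇔
        (λ ∈β → contradiction (antitone i α≤β ∈β) ∉α)
        (antitone i (<⇒≤ β<l))
      ... | no  ∄              = always λ α<l → mk⇔
        (λ _ → continuous i λ α α<l → decidable-stable em↓ λ ∉α → ∄ (α , α<l , ∉α))
        (antitone i (<⇒≤ α<l))
      quantifierFree-stable (φ ∧ᶠ χ) ρ =
        eventually-zipWith _×-⇔_ (quantifierFree-stable φ ρ) (quantifierFree-stable χ ρ)
      quantifierFree-stable (φ ∨ᶠ χ) ρ =
        eventually-zipWith _⊎-⇔_ (quantifierFree-stable φ ρ) (quantifierFree-stable χ ρ)
      quantifierFree-stable (φ ⇒ᶠ χ) ρ =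
        eventually-zipWith →-cong-⇔ (quantifierFree-stable φ ρ) (quantifierFree-stable χ ρ)

      clause-at-limit : (c : Clause {S = S} {ar = ar}) →
        (∀ α → α < l → 𝔸 ⊨ Clause.formula c [ R α ]) → 𝔸 ⊨ Clause.formula c [ R l ]
      clause-at-limit c below = from (Sat-∀* (R l) n) λ ρ premise-l →
        from (Sat-⋀ (R l) ρ conclusions) λ {(i , ts)} c∈ → continuous i λ α α<l →
        let α₀ , α₀<l , stable     = quantifierFree-stable quantifierFree ρ
            -- Past `α₀` the premise transfers from `l` to `β`; past `α` the conclusions transfer
            -- from `β` back to `α`.
            β , α≤β , α₀≤β , β<l = <-directed α<l α₀<l
            premise-β              = from (stable β α₀≤β β<l) premise-l
            conclusions-β          = to (Sat-∀* (R β) n) (below β β<l) ρ premise-β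
        in  antitone i α≤β (to (Sat-⋀ (R β) ρ conclusions) conclusions-β c∈)
        where open Clause c

  clause-of-full : (R : Relations 𝔸 ar) → (∀ i x → R i x) →
    (c : Clause {S = S} {ar = ar}) → 𝔸 ⊨ Clause.formula c [ R ]
  clause-of-full R full c = from (Sat-∀* R n) λ ρ _ →
    from (Sat-⋀ R ρ conclusions) λ {(i , ts)} _ → full i _
    where open Clause c

theorem4p29 : ∀ {s ℓ : Level} → ExcludedMiddle (lsuc ℓ) →
    (S : Signature s) {m : ℕ} (ar : Fin m → ℕ) (φ : Formula S ar 0) → Standard ℓ φ →
    (𝔸 : Structure S ℓ) (R : ∀ i → CoinductiveRelation (Carrier 𝔸) (ar i)) →
    (∀ (α : Ordinal ℓ) → 𝔸 ⊨ φ [ (λ i → approximant (R i) α) ] → 𝔸 ⊨ φ [ (λ i → approximant (R i) (α +1)) ]) →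
    (∀ (α : Ordinal ℓ) → 𝔸 ⊨ φ [ (λ i → approximant (R i) α) ]) × 𝔸 ⊨ φ [ (λ i → relation (R i)) ]
theorem4p29 {ℓ = ℓ} em S {m} ar φ (cs , φ⇔cs) 𝔸 R φ-suc =
  φ-approximant , to (Sat-cong 𝔸 reached φ []) (φ-approximant γ)
  where
  open Classical em
  open CoinductiveRelation
  open IsFinalSequence

  Rᵒ : Ordinal ℓ → Relations 𝔸 ar
  Rᵒ α i = approximant (R i) α

  fs : ∀ i → IsFinalSequence (operator (R i)) (approximant (R i))
  fs i = isFinalSequence (R i)

  via-clauses : ∀ α → (∀ c → c ∈ cs → 𝔸 ⊨ Clause.formula c [ Rᵒ α ]) → 𝔸 ⊨ φ [ Rᵒ α ]
  via-clauses α h = from (φ⇔cs 𝔸 (Rᵒ α)) (from (Sat-⋀ 𝔸 (Rᵒ α) [] cs) λ c∈ → h _ c∈)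

  φ-limit : ∀ l → IsLimit l → (∀ α → α < l → 𝔸 ⊨ φ [ Rᵒ α ]) → 𝔸 ⊨ φ [ Rᵒ l ]
  φ-limit l lim below = via-clauses l λ c c∈ →
    clause-at-limit 𝔸 em Rᵒ
      (λ i → finalSequence-antitone (monotone (R i)) (fs i))
      (proj₁ lim)
      (λ i → from (at-limit (fs i) l lim _))
      c
      λ α α<l → to (Sat-⋀ 𝔸 (Rᵒ α) [] cs) (to (φ⇔cs 𝔸 (Rᵒ α)) (below α α<l)) c∈

  φ-approximant : ∀ α → 𝔸 ⊨ φ [ Rᵒ α ]
  φ-approximant = transfiniteInduction (λ α → 𝔸 ⊨ φ [ Rᵒ α ])
    (λ α≈β → from (Sat-cong 𝔸 (λ i → cong (fs i) α≈β) φ []))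
    (via-clauses 0ᵒ λ c _ → clause-of-full 𝔸 (Rᵒ 0ᵒ) (λ i x → proj₂ (at-zero (fs i)) _) c)
    φ-suc
    φ-limit

  -- One stage past the closure ordinals of all `m` operators, so that every greatest fixpoint is
  -- reached at the same index.
  γ : Ordinal ℓ
  γ = sup (Lift ℓ (Fin m)) λ (lift i) → closureOrdinal (monotone (R i))

  reached : ∀ i → Rᵒ γ i ≐ relation (R i)
  reached i = finalSequence-reaches-gfp (monotone (R i)) (fs i) (isGreatestFixpoint (R i))
    (<⇒≤ {β = γ} (lift i , ≤-refl _))
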